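{- If $G$ is a permutation graph, then its oriented star-conflict graph $A_G$ is a cocomparability graph.
   Context: All graphs are finite, simple and undirected. A graph $G$ is a permutation graph if there are two linear orders $<_1,<_2$ on $V(G)$ such that two vertices are adjacent precisely when they occur in opposite orders in $<_1$ and $<_2$. An orientation of a graph is transitive if $x\to y$ and $y\to z$ imply that $xz$ is an edge oriented as $x\to z$. A graph is a comparability graph if it admits a transitive orientation, and a cocomparability graph if its complement is a comparability graph. The oriented star-conflict graph $A_G$ has vertex set $V(A_G)=\{(c,\ell): c\ell\in E(G)\}$, the set of ordered edges of $G$ (each edge gives two ordered edges). Two distinct ordered edges $(c,\ell)$ and $(d,r)$ are compatible if either (same centre) $c=d$, $\ell\ne r$ and $\ell r\notin E(G)$; or (different centres) $c\neq d$, the four vertices $c,\ell,d,r$ are distinct, and $cd,cr,\ell d,\ell r\notin E(G)$. Two distinct vertices of $A_G$ are adjacent if and only if the corresponding ordered edges are not compatible. -}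

module Defs where

open import Data.List.Base using (List; []; _∷_; concatMap; cartesianProduct)
open import Data.List.Membership.Propositional using (_∈_; lose)
open import Data.List.Membership.Propositional.Properties
  using (∈-concatMap⁺; ∈-cartesianProduct⁺)
open import Data.List.Relation.Unary.All using ([]; _∷_)
open import Data.List.Relation.Unary.AllPairs using ([]; _∷_)
open import Data.List.Relation.Unary.Any using (here)
open import Data.List.Relation.Unary.Enumerates.Setoid using (IsEnumeration)
import Data.List.Relation.Unary.Unique.DecPropositional as DecUnique
open import Data.List.Relation.Unary.Unique.Propositional using (Unique)
open import Data.Product.Base using (_×_; _,_)
open import Data.Sum.Base using (_⊎_; inj₁; inj₂)
open import Function.Base using (_∘_)
open import Function.Bundles using (_⇔_)
open import Level using (0ℓ)
open import Relation.Binary.Core using (Rel)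
open import Relation.Binary.Definitions
  using (Asymmetric; Decidable; DecidableEquality; Irreflexive; Symmetric; Transitive)
open import Relation.Binary.PropositionalEquality
  using (_≡_; _≢_; refl; sym; ≢-sym)
open import Relation.Binary.PropositionalEquality.Properties using (setoid)
open import Relation.Binary.Structures using (IsStrictTotalOrder)
open import Relation.Nullary.Decidable using (yes; no; ¬?; map′; _×-dec_; _⊎-dec_)
open import Relation.Nullary.Negation using (¬_; contradiction-irr)

-- Finiteness is a listing of the vertices, possibly with repetitions.  For
-- finite graphs the two decidability fields are no restriction classically.
record Graph : Set₁ where
  infix 4 _~_ _~?_ _≟_
  field
    Vertex     : Set
    _≟_        : DecidableEquality Vertex
    vertices   : List Vertex
    enumerates : IsEnumeration (setoid Vertex) vertices
    _~_        : Rel Vertex 0ℓ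
    _~?_       : Decidable _~_
    ~-sym      : Symmetric _~_
    ~-irrefl   : Irreflexive _≡_ _~_

complement : Graph → Graph
complement G = record
  { Vertex     = Vertex
  ; _≟_        = _≟_
  ; vertices   = vertices
  ; enumerates = enumerates
  ; _~_        = λ x y → x ≢ y × ¬ (x ~ y)
  ; _~?_       = λ x y → ¬? (x ≟ y) ×-dec ¬? (x ~? y)
  ; ~-sym      = λ (x≢y , x≁y) → ≢-sym x≢y , x≁y ∘ ~-sym
  ; ~-irrefl   = λ x≡y (x≢y , _) → x≢y x≡y
  }
  where open Graph G

record IsOrientation (G : Graph) (_⟶_ : Rel (Graph.Vertex G) 0ℓ) : Set where
  open Graph G
  field
    arc⇒edge : ∀ {x y} → x ⟶ y → x ~ y
    edge⇒arc : ∀ {x y} → x ~ y → x ⟶ y ⊎ y ⟶ x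
    asym     : Asymmetric _⟶_

record IsComparabilityGraph (G : Graph) : Set₁ where
  open Graph G
  field
    _⟶_           : Rel Vertex 0ℓ
    isOrientation : IsOrientation G _⟶_
    transitive    : Transitive _⟶_

IsCocomparabilityGraph : Graph → Set₁
IsCocomparabilityGraph G = IsComparabilityGraph (complement G)

record IsPermutationGraph (G : Graph) : Set₁ where
  open Graph G
  field
    _<₁_ _<₂_             : Rel Vertex 0ℓ
    <₁-isStrictTotalOrder : IsStrictTotalOrder _≡_ _<₁_
    <₂-isStrictTotalOrder : IsStrictTotalOrder _≡_ _<₂_
    edge⇔opposite         : ∀ {x y} → x ~ y ⇔ ((x <₁ y × y <₂ x) ⊎ (y <₁ x × x <₂ y))

-- The irrelevant field makes equality of ordered edges equality of their ends;
-- the adjacency proof is recoverable by `recompute`, as `_~_` is decidable.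
record OrderedEdge (G : Graph) : Set where
  constructor orderedEdge
  open Graph G
  field
    centre leaf : Vertex
    .edge       : centre ~ leaf

module _ (G : Graph) where
  open Graph G
  open OrderedEdge

  Compatible : Rel (OrderedEdge G) 0ℓ
  Compatible (orderedEdge c ℓ _) (orderedEdge d r _) =
      (c ≡ d × ℓ ≢ r × ¬ (ℓ ~ r))
    ⊎ (c ≢ d × Unique (c ∷ ℓ ∷ d ∷ r ∷ [])
             × ¬ (c ~ d) × ¬ (c ~ r) × ¬ (ℓ ~ d) × ¬ (ℓ ~ r))

  compatible? : Decidable Compatible
  compatible? (orderedEdge c ℓ _) (orderedEdge d r _) =
      ((c ≟ d) ×-dec ¬? (ℓ ≟ r) ×-dec ¬? (ℓ ~? r))
    ⊎-dec
      (¬? (c ≟ d) ×-dec DecUnique.unique? _≟_ (c ∷ ℓ ∷ d ∷ r ∷ [])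
        ×-dec ¬? (c ~? d) ×-dec ¬? (c ~? r) ×-dec ¬? (ℓ ~? d) ×-dec ¬? (ℓ ~? r))

  compatible-sym : Symmetric Compatible
  compatible-sym (inj₁ (c≡d , ℓ≢r , ℓ≁r)) = inj₁ (sym c≡d , ≢-sym ℓ≢r , ℓ≁r ∘ ~-sym)
  compatible-sym
    (inj₂ (_ , ((c≢ℓ ∷ c≢d ∷ c≢r ∷ []) ∷ (ℓ≢d ∷ ℓ≢r ∷ []) ∷ (d≢r ∷ []) ∷ [] ∷ [])
             , c≁d , c≁r , ℓ≁d , ℓ≁r)) =
    inj₂ (≢-sym c≢d
         , ((d≢r ∷ ≢-sym c≢d ∷ ≢-sym ℓ≢d ∷ []) ∷ (≢-sym c≢r ∷ ≢-sym ℓ≢r ∷ [])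
             ∷ (c≢ℓ ∷ []) ∷ [] ∷ [])
         , c≁d ∘ ~-sym , ℓ≁d ∘ ~-sym , c≁r ∘ ~-sym , ℓ≁r ∘ ~-sym)

  orderedEdge-≟ : DecidableEquality (OrderedEdge G)
  orderedEdge-≟ (orderedEdge c ℓ _) (orderedEdge d r _) =
    map′ (λ { (refl , refl) → refl }) (λ { refl → refl , refl }) ((c ≟ d) ×-dec (ℓ ≟ r))

  toOrderedEdge : Vertex × Vertex → List (OrderedEdge G)
  toOrderedEdge (c , ℓ) with c ~? ℓ
  ... | yes c~ℓ = orderedEdge c ℓ c~ℓ ∷ []
  ... | no  _   = []

  ∈-toOrderedEdge : ∀ e → e ∈ toOrderedEdge (centre e , leaf e)
  ∈-toOrderedEdge (orderedEdge c ℓ c~ℓ) with c ~? ℓ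
  ... | yes _   = here refl
  ... | no  c≁ℓ = contradiction-irr c~ℓ c≁ℓ

  orderedEdges : List (OrderedEdge G)
  orderedEdges = concatMap toOrderedEdge (cartesianProduct vertices vertices)

  orderedEdges-enumerates : IsEnumeration (setoid (OrderedEdge G)) orderedEdges
  orderedEdges-enumerates e = ∈-concatMap⁺ toOrderedEdge
    (lose (∈-cartesianProduct⁺ (enumerates (centre e)) (enumerates (leaf e)))
          (∈-toOrderedEdge e))

  starConflictGraph : Graph
  starConflictGraph = record
    { Vertex     = OrderedEdge G
    ; _≟_        = orderedEdge-≟
    ; vertices   = orderedEdges
    ; enumerates = orderedEdges-enumerates
    ; _~_        = λ e f → e ≢ f × ¬ Compatible e f
    ; _~?_       = λ e f → ¬? (orderedEdge-≟ e f) ×-dec ¬? (compatible? e f)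
    ; ~-sym      = λ {e} {f} (e≢f , ¬ef) → ≢-sym e≢f , ¬ef ∘ compatible-sym {f} {e}
    ; ~-irrefl   = λ e≡f (e≢f , _) → e≢f e≡f
    }

{-# OPTIONS --safe #-}
-- The two orders of a permutation graph agree exactly on the non-edges, so
-- their intersection ≪ transitively orients the complement.  A transitive
-- orientation of the complement is all that is needed from here on: in a
-- compatible pair with different centres, one edge lies entirely ≪-below the
-- other, since c ≪ d and r ≪ c would give r ≪ d although dr is an edge.
-- Hence "leaf below leaf, and equal centres or everything below everything"
-- transitively orients compatibility.
module Submission where

open import Defs
open import Data.List.Relation.Unary.All using ([]; _∷_)
open import Data.List.Relation.Unary.AllPairs using ([]; _∷_)
open import Data.Product.Base using (_×_; _,_; proj₁; proj₂)
open import Data.Sum.Base using (_⊎_; inj₁; inj₂; [_,_]′; map)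
open import Function.Base using (_∘_)
open import Function.Bundles using (Equivalence)
open import Level using (0ℓ)
open import Relation.Binary.Core using (Rel)
open import Relation.Binary.Definitions using (Transitive; tri<; tri≈; tri>)
open import Relation.Binary.PropositionalEquality using (_≡_; _≢_; refl; sym)
open import Relation.Binary.Structures using (IsStrictTotalOrder)
open import Relation.Nullary.Decidable using (decidable-stable; recompute)
open import Relation.Nullary.Negation using (¬_; contradiction)

permutation⇒cocomparability : (G : Graph) → IsPermutationGraph G → IsCocomparabilityGraph G
permutation⇒cocomparability G perm = record
  { _⟶_           = _≪_
  ; isOrientation = record
    { arc⇒edge = ≪⇒nonadjacent
    ; edge⇒arc = nonadjacent⇒≪
    ; asym     = λ (x<₁y , _) (y<₁x , _) → O₁.asym x<₁y y<₁x
    }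
  ; transitive    = λ (x<₁y , x<₂y) (y<₁z , y<₂z) → O₁.trans x<₁y y<₁z , O₂.trans x<₂y y<₂z
  }
  where
  open Graph G
  open IsPermutationGraph perm
  module O₁ = IsStrictTotalOrder <₁-isStrictTotalOrder
  module O₂ = IsStrictTotalOrder <₂-isStrictTotalOrder

  _≪_ : Rel Vertex 0ℓ
  x ≪ y = x <₁ y × x <₂ y

  ≪⇒nonadjacent : ∀ {x y} → x ≪ y → x ≢ y × ¬ (x ~ y)
  ≪⇒nonadjacent (x<₁y , x<₂y) =
      (λ x≡y → O₁.irrefl x≡y x<₁y)
    , [ (λ (_ , y<₂x) → O₂.asym x<₂y y<₂x) , (λ (y<₁x , _) → O₁.asym x<₁y y<₁x) ]′
        ∘ Equivalence.to edge⇔opposite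

  -- A pair on which the two orders disagree is an inversion, hence an edge, so only the agreeing
  -- cases survive.
  nonadjacent⇒≪ : ∀ {x y} → x ≢ y × ¬ (x ~ y) → x ≪ y ⊎ y ≪ x
  nonadjacent⇒≪ {x} {y} (x≢y , x≁y) with O₁.compare x y | O₂.compare x y
  ... | tri< x<₁y _ _ | tri< x<₂y _ _ = inj₁ (x<₁y , x<₂y)
  ... | tri> _ _ y<₁x | tri> _ _ y<₂x = inj₂ (y<₁x , y<₂x)
  ... | tri< x<₁y _ _ | tri> _ _ y<₂x =
    contradiction (Equivalence.from edge⇔opposite (inj₁ (x<₁y , y<₂x))) x≁y
  ... | tri> _ _ y<₁x | tri< x<₂y _ _ =
    contradiction (Equivalence.from edge⇔opposite (inj₂ (y<₁x , x<₂y))) x≁y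
  ... | tri≈ _ x≡y _  | _             = contradiction x≡y x≢y
  ... | _             | tri≈ _ x≡y _  = contradiction x≡y x≢y

starConflictGraph-cocomparability :
  (G : Graph) → IsCocomparabilityGraph G → IsCocomparabilityGraph (starConflictGraph G)
starConflictGraph-cocomparability G cocomp = record
  { _⟶_           = _⇒_
  ; isOrientation = record
    { arc⇒edge = λ {e} {f} e⇒f →
        ⇒-distinct e⇒f , λ (_ , ¬comp) → ¬comp (⇒-compatible e f e⇒f)
    ; edge⇒arc = λ {e} {f} (e≢f , ¬conflict) →
        compatible⇒comparable e f
          -- Non-adjacency in the conflict graph yields only the double negation of `Compatible`;
          -- decidability removes it.
          (decidable-stable (compatible? G e f) (λ ¬comp → ¬conflict (e≢f , ¬comp)))
    ; asym     = λ (ℓ≪r , _) (r≪ℓ , _) → ≪-asym ℓ≪r r≪ℓ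
    }
  ; transitive    = λ {e} {f} {g} → ⇒-trans {e} {f} {g}
  }
  where
  open Graph G
  open OrderedEdge
  open IsComparabilityGraph cocomp renaming (_⟶_ to _≪_; transitive to ≪-trans)
  open IsOrientation isOrientation
    renaming (arc⇒edge to ≪⇒nonadjacent; edge⇒arc to nonadjacent⇒≪; asym to ≪-asym)

  ≪⇒≢ : ∀ {x y} → x ≪ y → x ≢ y
  ≪⇒≢ = proj₁ ∘ ≪⇒nonadjacent

  ≪⇒≁ : ∀ {x y} → x ≪ y → ¬ (x ~ y)
  ≪⇒≁ = proj₂ ∘ ≪⇒nonadjacent

  -- The irrelevant argument matches the `edge` field of `OrderedEdge`; deciding adjacency recovers
  -- a usable proof.
  ~⇒≢ : ∀ {x y} → .(x ~ y) → x ≢ y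
  ~⇒≢ {x} {y} x~y x≡y = ~-irrefl x≡y (recompute (x ~? y) x~y)

  -- The other direction `z ≪ y` would give `x ≪ y` by transitivity, contradicting the edge between
  -- `x` and `y`. This carries a comparison from one end of an edge to the other.
  ≪-respˡ-~ : ∀ {x y z} → .(x ~ y) → y ≢ z → ¬ (y ~ z) → x ≪ z → y ≪ z
  ≪-respˡ-~ {x} {y} x~y y≢z y≁z x≪z with nonadjacent⇒≪ (y≢z , y≁z)
  ... | inj₁ y≪z = y≪z
  ... | inj₂ z≪y = contradiction (recompute (x ~? y) x~y) (≪⇒≁ (≪-trans x≪z z≪y))

  ≪-respʳ-~ : ∀ {x y z} → .(y ~ z) → x ≢ z → ¬ (x ~ z) → x ≪ y → x ≪ z
  ≪-respʳ-~ {y = y} {z} y~z x≢z x≁z x≪y with nonadjacent⇒≪ (x≢z , x≁z)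
  ... | inj₁ x≪z = x≪z
  ... | inj₂ z≪x = contradiction (~-sym (recompute (y ~? z) y~z)) (≪⇒≁ (≪-trans z≪x x≪y))

  -- The leaf comparison is kept outside the disjunction, so asymmetry can be read off from the
  -- leaves alone.
  _⇒_ : Rel (OrderedEdge G) 0ℓ
  e ⇒ f = leaf e ≪ leaf f
        × (centre e ≡ centre f
           ⊎ (centre e ≪ centre f × centre e ≪ leaf f × leaf e ≪ centre f))

  ⇒-distinct : ∀ {e f} → e ⇒ f → e ≢ f
  ⇒-distinct (ℓ≪r , _) refl = ≪-asym ℓ≪r ℓ≪r

  -- If exactly one step keeps its centre, one cross comparison must be rebuilt, and it passes
  -- through the middle leaf; if both steps change centre, everything but the leaf comparison passes
  -- through the middle centre.
  ⇒-trans : Transitive _⇒_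
  ⇒-trans (ℓ≪r , inj₁ refl) (r≪s , inj₁ refl) = ≪-trans ℓ≪r r≪s , inj₁ refl
  ⇒-trans (ℓ≪r , inj₁ refl) (r≪s , inj₂ (d≪e , d≪s , r≪e)) =
    ≪-trans ℓ≪r r≪s , inj₂ (d≪e , d≪s , ≪-trans ℓ≪r r≪e)
  ⇒-trans (ℓ≪r , inj₂ (c≪d , c≪r , ℓ≪d)) (r≪s , inj₁ refl) =
    ≪-trans ℓ≪r r≪s , inj₂ (c≪d , ≪-trans c≪r r≪s , ℓ≪d)
  ⇒-trans (ℓ≪r , inj₂ (c≪d , c≪r , ℓ≪d)) (r≪s , inj₂ (d≪e , d≪s , r≪e)) =
    ≪-trans ℓ≪r r≪s , inj₂ (≪-trans c≪d d≪e , ≪-trans c≪d d≪s , ≪-trans ℓ≪d d≪e)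

  ⇒-compatible : ∀ e f → e ⇒ f → Compatible G e f
  ⇒-compatible _ _ (ℓ≪r , inj₁ c≡d) = inj₁ (c≡d , ≪⇒≢ ℓ≪r , ≪⇒≁ ℓ≪r)
  ⇒-compatible (orderedEdge c ℓ c~ℓ) (orderedEdge d r d~r) (ℓ≪r , inj₂ (c≪d , c≪r , ℓ≪d)) =
    inj₂ ( ≪⇒≢ c≪d
         , ( (~⇒≢ c~ℓ ∷ ≪⇒≢ c≪d ∷ ≪⇒≢ c≪r ∷ [])
           ∷ (≪⇒≢ ℓ≪d ∷ ≪⇒≢ ℓ≪r ∷ [])
           ∷ (~⇒≢ d~r ∷ [])
           ∷ [] ∷ [])
         , ≪⇒≁ c≪d , ≪⇒≁ c≪r , ≪⇒≁ ℓ≪d , ≪⇒≁ ℓ≪r)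

  centre≪⇒⇒ : ∀ e f → Compatible G e f → centre e ≪ centre f → e ⇒ f
  centre≪⇒⇒ _ _ (inj₁ (c≡d , _)) c≪d = contradiction c≡d (≪⇒≢ c≪d)
  centre≪⇒⇒ (orderedEdge c ℓ c~ℓ) (orderedEdge d r d~r)
    (inj₂ (_ , ((_ ∷ _ ∷ c≢r ∷ []) ∷ (ℓ≢d ∷ ℓ≢r ∷ []) ∷ _) , _ , c≁r , ℓ≁d , ℓ≁r)) c≪d =
    -- The edge from `d` to `r` turns `c ≪ d` into `c ≪ r`; the edge from `c` to `ℓ` then replaces
    -- `c` by `ℓ` in both.
    ≪-respˡ-~ c~ℓ ℓ≢r ℓ≁r c≪r , inj₂ (c≪d , c≪r , ≪-respˡ-~ c~ℓ ℓ≢d ℓ≁d c≪d)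
    where
    c≪r : c ≪ r
    c≪r = ≪-respʳ-~ d~r c≢r c≁r c≪d

  compatible⇒comparable : ∀ e f → Compatible G e f → e ⇒ f ⊎ f ⇒ e
  compatible⇒comparable _ _ (inj₁ (c≡d , ℓ≢r , ℓ≁r)) =
    map (_, inj₁ c≡d) (_, inj₁ (sym c≡d)) (nonadjacent⇒≪ (ℓ≢r , ℓ≁r))
  compatible⇒comparable e f comp@(inj₂ (c≢d , _ , c≁d , _)) =
    -- Symmetry of compatibility covers the case where the second centre is the lower one.
    map (centre≪⇒⇒ e f comp) (centre≪⇒⇒ f e (compatible-sym G {e} {f} comp))
        (nonadjacent⇒≪ (c≢d , c≁d))

theorem5 : (G : Graph) → IsPermutationGraph G → IsCocomparabilityGraph (starConflictGraph G)
theorem5 G perm = starConflictGraph-cocomparability G (permutation⇒cocomparability G perm)
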